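{- Let $\Phi$ be a contradiction (that is, an unsatisfiable formula) in 3-CNF and let $k$ be arbitrary. Then $(\Phi,k)$ has fpt-bounded refutations (of size $\leq 3^{k+1}$) in $\mathrm{W}[1]$-parameterized tree-Resolution.
   Context: A 3-CNF is a CNF with at most three literals per clause; $k$ is a natural number, the parameter. Resolution is a refutation system for unsatisfiable CNFs, operating on clauses. Its rules are: the resolution rule (from $P\vee x$ and $Q\vee\neg x$ derive $P\vee Q$, where $P,Q$ are disjunctions of literals) and weakening (from $P$ derive $P\vee l$ for a literal $l$). A refutation is a DAG whose sources are labelled by initial clauses, whose internal nodes are labelled by derived clauses, and whose unique sink is labelled by the empty clause. The size of a refutation is the size of this DAG. Tree-Resolution is the restriction in which the DAG must be a tree. For a 3-CNF $\mathcal{F}$ in variables $x_1,\ldots,x_n$ with no satisfying assignment having exactly $k$ variables true, a $\mathrm{W}[1]$-parameterized tree-Resolution refutation of $(\mathcal{F},k)$ is a tree-Resolution refutation of the CNF $$\mathcal{F}\ \cup\ \{\neg x_{i_1}\vee\ldots\vee\neg x_{i_{k+1}} : 1\le i_1<\ldots<i_{k+1}\le n\}\ \cup\ \{x_{i_1}\vee\ldots\vee x_{i_{n-k+1}} : 1\le i_1<\ldots<i_{n-k+1}\le n\}.$$ Only those of the additional clauses that actually appear in the refutation count towards its size. Refutations of pairs $(\Phi,k)$ are fpt-bounded if there is a computable function $f$ such that each $(\Phi,k)$ has a refutation of size at most $f(k)\cdot|\Phi|^{O(1)}$.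
   Formalization: The size bound 3^{k+1} is replaced by 3·3^{k+1} − 2, counting all nodes; the stated bound fails for k = 0 and the eight width-3 clauses over three variables, which have no refutation with at most 3 nodes. -}

module Defs where

open import Data.Bool using (Bool; true; false)
open import Data.Fin using (Fin)
open import Data.Fin.Subset using (Subset; _∪_; ⁅_⁆; ∣_∣) renaming (⊥ to ∅; _∈_ to _∈ₛ_)
open import Data.List using (List; map)
open import Data.List.Membership.Propositional using (_∈_)
open import Data.List.Relation.Unary.All using (All)
open import Data.Nat using (ℕ; suc; _+_; _*_; _^_; _≤_; _<_)
open import Data.Nat.ListAction using (sum)
open import Data.Product using (Σ; ∃-syntax; _×_)
open import Data.Sum using (_⊎_)
open import Data.Vec using (Vec; []; _∷_; lookup)
open import Level using (0ℓ)
open import Relation.Binary.PropositionalEquality using (_≡_)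
open import Relation.Nullary using (¬_)
open import Relation.Unary using (Pred)

private variable
  n m : ℕ

data Literal (n : ℕ) : Set where
  +ℓ -ℓ : Fin n → Literal n

-- A clause is the finite set of its literals, split into the variables that
-- occur positively and those that occur negatively; both may contain the same
-- variable.  Propositional equality is thus equality of sets of literals.
record Clause (n : ℕ) : Set where
  constructor clause
  field
    positive negative : Subset n

open Clause public

infixl 6 _∨_ _∨ℓ_

_∨_ : Clause n → Clause n → Clause n
clause P N ∨ clause P′ N′ = clause (P ∪ P′) (N ∪ N′)

literal : Literal n → Clause n
literal (+ℓ x) = clause ⁅ x ⁆ ∅
literal (-ℓ x) = clause ∅ ⁅ x ⁆

_∨ℓ_ : Clause n → Literal n → Clause n
C ∨ℓ l = C ∨ literal l

□ : Clause n
□ = clause ∅ ∅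

width : Clause n → ℕ
width C = ∣ positive C ∣ + ∣ negative C ∣

CNF : ℕ → Set
CNF n = List (Clause n)

Is3CNF : CNF n → Set
Is3CNF = All λ C → width C ≤ 3

-- The summand 1 per clause makes the empty clause count too.
‖_‖ : CNF n → ℕ
‖ Φ ‖ = sum (map (λ C → 1 + width C) Φ)

Assignment : ℕ → Set
Assignment n = Fin n → Bool

infix 4 _⊨_

_⊨_ : Assignment n → Clause n → Set
α ⊨ C = (∃[ x ] x ∈ₛ positive C × α x ≡ true) ⊎ (∃[ x ] x ∈ₛ negative C × α x ≡ false)

Unsatisfiable : CNF n → Set
Unsatisfiable Φ = ∀ α → ¬ All (α ⊨_) Φ

data TreeResolution {n : ℕ} (𝒜 : Pred (Clause n) 0ℓ) : Clause n → Set where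
  initial : ∀ {C} → 𝒜 C → TreeResolution 𝒜 C
  resolve : ∀ {P Q} x → TreeResolution 𝒜 (P ∨ℓ +ℓ x) → TreeResolution 𝒜 (Q ∨ℓ -ℓ x) →
            TreeResolution 𝒜 (P ∨ Q)
  weaken  : ∀ {P} l → TreeResolution 𝒜 P → TreeResolution 𝒜 (P ∨ℓ l)

-- Every node counts, leaves included.  With this measure the ternary-branching
-- refutations of W[1]-parameterized tree-Resolution have 3 * 3 ^ (k + 1) ∸ 2
-- nodes, and 3 ^ (k + 1) cannot be reached in general: the eight clauses of
-- width 3 over three variables need 7 nodes for k = 0.
size : ∀ {𝒜 : Pred (Clause n) 0ℓ} {C} → TreeResolution 𝒜 C → ℕ
size (initial _)     = 1
size (resolve _ π ρ) = 1 + size π + size ρ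
size (weaken _ π)    = 1 + size π

-- The clauses that may label leaves.  The cardinality condition of `atLeast`
-- is ∣ S ∣ = n - k + 1 over the integers, so there are none when k > n + 1.
data W1Clause {n : ℕ} (Φ : CNF n) (k : ℕ) : Pred (Clause n) 0ℓ where
  original : ∀ {C} → C ∈ Φ → W1Clause Φ k C
  atMost   : ∀ S → ∣ S ∣ ≡ k + 1 → W1Clause Φ k (clause ∅ S)
  atLeast  : ∀ S → ∣ S ∣ + k ≡ n + 1 → W1Clause Φ k (clause S ∅)

W1TreeRefutation : CNF n → ℕ → Set
W1TreeRefutation Φ k = TreeResolution (W1Clause Φ k) □

data Recursive : ℕ → Set where
  zeroᶜ : Recursive 0
  sucᶜ  : Recursive 1
  projᶜ : Fin n → Recursive n
  compᶜ : Recursive m → Vec (Recursive n) m → Recursive n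
  precᶜ : Recursive n → Recursive (2 + n) → Recursive (1 + n)
  minᶜ  : Recursive (1 + n) → Recursive n

infix 4 _·_⇓_

data _·_⇓_ : Recursive n → Vec ℕ n → ℕ → Set where
  ⇓zero  : zeroᶜ · [] ⇓ 0
  ⇓suc   : ∀ {a} → sucᶜ · a ∷ [] ⇓ suc a
  ⇓proj  : ∀ {i} {as : Vec ℕ n} → projᶜ i · as ⇓ lookup as i
  ⇓comp  : ∀ {g : Recursive m} {hs : Vec (Recursive n) m} {as bs b} →
           (∀ i → lookup hs i · as ⇓ lookup bs i) → g · bs ⇓ b → compᶜ g hs · as ⇓ b
  ⇓prec₀ : ∀ {g : Recursive n} {h as b} →
           g · as ⇓ b → precᶜ g h · 0 ∷ as ⇓ b
  ⇓precₛ : ∀ {g : Recursive n} {h a as r b} →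
           precᶜ g h · a ∷ as ⇓ r → h · a ∷ r ∷ as ⇓ b → precᶜ g h · suc a ∷ as ⇓ b
  ⇓min   : ∀ {g : Recursive (1 + n)} {as b} →
           g · b ∷ as ⇓ 0 → (∀ a → a < b → ∃[ r ] g · a ∷ as ⇓ suc r) → minᶜ g · as ⇓ b

Computable : (ℕ → ℕ) → Set
Computable f = Σ (Recursive 1) λ c → ∀ k → c · k ∷ [] ⇓ f k

-- f and the exponent e are uniform over all pairs (Φ , k) of the class 𝒞, in
-- particular over the number of variables.
FptBounded : (∀ {n} → CNF n → ℕ → Set) → Set
FptBounded 𝒞 =
  ∃[ f ] Computable f × (∃[ e ] (∀ {n} (Φ : CNF n) k → 𝒞 Φ k →
    Σ (W1TreeRefutation Φ k) λ π → size π ≤ f k * ‖ Φ ‖ ^ e))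

-- Let S be a set of at most k variables.  The assignment that makes exactly S
-- true falsifies some clause C of Φ: its negative variables lie in S, its at
-- most three positive ones outside S.  Recursively, for each positive x of C,
-- derive a clause of negated variables from S ∪ ⁅ x ⁆, and resolve these
-- against C; what remains is a clause of negated variables from S, and for
-- S = ∅ it is □.  At ∣ S ∣ = k + 1 the recursion stops with an `atMost` clause.
-- Deriving only a subclause of clause ∅ S avoids all weakenings.
module Submission where

open import Defs
open import Data.Bool using (true; false; _≟_)
open import Data.Fin using (zero; suc)
open import Data.Fin.Patterns using (0F; 1F)
open import Data.Fin.Properties using (any?)
open import Data.Fin.Subset using (Subset; inside; outside; _∈_; _∉_; _⊆_; _∪_; _-_; ⁅_⁆; ∣_∣) renaming (⊥ to ∅)
open import Data.Fin.Subset.Properties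
open import Data.List.Membership.Propositional using (find)
open import Data.List.Relation.Unary.All using (lookup)
open import Data.List.Relation.Unary.All.Properties using (¬All⇒Any¬)
open import Data.Nat using (ℕ; zero; suc; _+_; _*_; _^_; _∸_; _≤_; s≤s)
open import Data.Nat.Properties hiding (_≟_)
open import Data.Nat.Solver using (module +-*-Solver)
open import Data.Product using (Σ; ∃-syntax; _×_; _,_)
open import Data.Sum using (inj₁; inj₂)
open import Data.Vec using (Vec; []; _∷_; here; there) renaming (lookup to lookupᵛ)
open import Data.Vec.Properties using (lookup⇒[]=; []=⇒lookup)
open import Function using (_∘_)
open import Relation.Binary.PropositionalEquality using (_≡_; refl; sym; trans; cong; cong₂; subst; subst₂)
open import Relation.Nullary using (¬_; Dec; yes; no; contradiction; _×-dec_; _⊎-dec_)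
open import Relation.Unary using (Pred)
open import Level using (0ℓ)

private variable
  n : ℕ

x∉p-x : ∀ (p : Subset n) x → x ∉ p - x
x∉p-x (_ ∷ p) zero    ()
x∉p-x (_ ∷ p) (suc x) (there x∈) = x∉p-x p x x∈

x∈p⇒p-x∪⁅x⁆≡p : ∀ {p : Subset n} {x} → x ∈ p → (p - x) ∪ ⁅ x ⁆ ≡ p
x∈p⇒p-x∪⁅x⁆≡p {p = _ ∷ p} here = cong (inside ∷_) (trans (∪-identityʳ _) (p─⊥≡p p))
x∈p⇒p-x∪⁅x⁆≡p {p = inside  ∷ _} (there x∈p) = cong (inside ∷_) (x∈p⇒p-x∪⁅x⁆≡p x∈p)
x∈p⇒p-x∪⁅x⁆≡p {p = outside ∷ _} (there x∈p) = cong (outside ∷_) (x∈p⇒p-x∪⁅x⁆≡p x∈p)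

x∉p⇒∣p∪⁅x⁆∣≡1+∣p∣ : ∀ {p : Subset n} {x} → x ∉ p → ∣ p ∪ ⁅ x ⁆ ∣ ≡ suc ∣ p ∣
x∉p⇒∣p∪⁅x⁆∣≡1+∣p∣ {p = inside  ∷ p} {zero}  x∉p = contradiction here x∉p
x∉p⇒∣p∪⁅x⁆∣≡1+∣p∣ {p = outside ∷ p} {zero}  x∉p = cong (suc ∘ ∣_∣) (∪-identityʳ p)
x∉p⇒∣p∪⁅x⁆∣≡1+∣p∣ {p = inside  ∷ p} {suc x} x∉p = cong suc (x∉p⇒∣p∪⁅x⁆∣≡1+∣p∣ (x∉p ∘ there))
x∉p⇒∣p∪⁅x⁆∣≡1+∣p∣ {p = outside ∷ p} {suc x} x∉p = x∉p⇒∣p∪⁅x⁆∣≡1+∣p∣ (x∉p ∘ there)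

p⊆q∪⁅x⁆∧x∉p⇒p⊆q : ∀ {p q : Subset n} {x} → p ⊆ q ∪ ⁅ x ⁆ → x ∉ p → p ⊆ q
p⊆q∪⁅x⁆∧x∉p⇒p⊆q {q = q} {x} p⊆ x∉p y∈p with x∈p∪q⁻ q ⁅ x ⁆ (p⊆ y∈p)
... | inj₁ y∈q = y∈q
... | inj₂ y∈⁅x⁆ with refl ← x∈⁅y⁆⇒x≡y x y∈⁅x⁆ = contradiction y∈p x∉p

p⊆r∧q⊆r⇒p∪q⊆r : ∀ {p q r : Subset n} → p ⊆ r → q ⊆ r → p ∪ q ⊆ r
p⊆r∧q⊆r⇒p∪q⊆r {p = p} {q} p⊆r q⊆r x∈ with x∈p∪q⁻ p q x∈
... | inj₁ x∈p = p⊆r x∈p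
... | inj₂ x∈q = q⊆r x∈q

infix 4 _⊨?_

_⊨?_ : (α : Assignment n) (C : Clause n) → Dec (α ⊨ C)
α ⊨? C = any? (λ x → (x ∈? positive C) ×-dec (α x ≟ true))
   ⊎-dec any? (λ x → (x ∈? negative C) ×-dec (α x ≟ false))

module _ (S : Subset n) {C : Clause n} (S⊭C : ¬ lookupᵛ S ⊨ C) where

  falsified⇒positive∉ : ∀ {x} → x ∈ positive C → x ∉ S
  falsified⇒positive∉ x∈P x∈S = S⊭C (inj₁ (_ , x∈P , []=⇒lookup x∈S))

  falsified⇒negative⊆ : negative C ⊆ S
  falsified⇒negative⊆ {x} x∈N with lookupᵛ S x in eq
  ... | true  = lookup⇒[]= x S eq
  ... | false = contradiction (inj₂ (x , x∈N , eq)) S⊭C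

Derivation≤ : Pred (Clause n) 0ℓ → Clause n → ℕ → Set
Derivation≤ 𝒜 C s = Σ (TreeResolution 𝒜 C) λ π → size π ≤ s

NegativeWithin : Pred (Clause n) 0ℓ → Subset n → ℕ → Set
NegativeWithin 𝒜 S s = ∃[ N ] N ⊆ S × Derivation≤ 𝒜 (clause ∅ N) s

module _ {𝒜 : Pred (Clause n) 0ℓ} where

  -- The resolution node is charged to the negative premise, hence `s + suc t`: each round of
  -- `eliminatePositive` then adds exactly one `suc t`.
  resolve≤ : ∀ {P N M x s t} → x ∈ P → x ∈ M →
             Derivation≤ 𝒜 (clause P N) s → Derivation≤ 𝒜 (clause ∅ M) t →
             Derivation≤ 𝒜 (clause (P - x) (N ∪ (M - x))) (s + suc t)
  resolve≤ {P} {N} {M} {x} {s} {t} x∈P x∈M d e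
    -- `resolve` expects premises ending in `∨ℓ`, so `x` is split off as a union, and the opposite
    -- polarity acquires a union with `∅`.
    with π , ∣π∣≤s ← subst (λ C → Derivation≤ 𝒜 C s)
           (sym (cong₂ clause (x∈p⇒p-x∪⁅x⁆≡p x∈P) (∪-identityʳ N))) d
       | ρ , ∣ρ∣≤t ← subst (λ C → Derivation≤ 𝒜 C t)
           (sym (cong₂ clause (∪-identityʳ ∅) (x∈p⇒p-x∪⁅x⁆≡p x∈M))) e
    = subst (λ Q → Derivation≤ 𝒜 (clause Q (N ∪ (M - x))) (s + suc t)) (∪-identityʳ (P - x))
        (resolve {P = clause (P - x) N} {Q = clause ∅ (M - x)} x π ρ ,
         subst (suc (size π + size ρ) ≤_) (sym (+-suc s t)) (s≤s (+-mono-≤ ∣π∣≤s ∣ρ∣≤t)))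

  -- Induction on `m`. Resolving on `x` removes it from `P` and adds only `M - x`, which lies in
  -- `S`; as `S` stays fixed, the same `branch` serves the remaining variables.
  eliminatePositive : ∀ m {P N S s t} → ∣ P ∣ ≤ m → N ⊆ S → Derivation≤ 𝒜 (clause P N) s →
                      (∀ {x} → x ∈ P → NegativeWithin 𝒜 (S ∪ ⁅ x ⁆) t) →
                      NegativeWithin 𝒜 S (s + m * suc t)
  eliminatePositive m {P} {N} {S} {s} {t} ∣P∣≤m N⊆S d branch with nonempty? P
  ... | no P-empty with refl ← Empty-unique P-empty | π , ∣π∣≤s ← d =
    N , N⊆S , π , ≤-trans ∣π∣≤s (m≤m+n s _)
  -- Since `P` is nonempty, `m` is a successor.
  ... | yes (x , x∈P) with m | ≤-trans (x∈p⇒∣p-x∣<∣p∣ x∈P) ∣P∣≤m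
  ...   | suc m′ | s≤s ∣P-x∣≤m′ with branch x∈P
  ...     | M , M⊆ , e with x ∈? M
  -- Here `M` lies in `S` already: the branch alone suffices, and `d` is dropped.
  ...       | no x∉M with ρ , ∣ρ∣≤t ← e =
    M , p⊆q∪⁅x⁆∧x∉p⇒p⊆q M⊆ x∉M , ρ ,
    ≤-trans ∣ρ∣≤t (≤-trans (n≤1+n t) (≤-trans (m≤m+n (suc t) _) (m≤n+m _ s)))
  ...       | yes x∈M =
    subst (NegativeWithin 𝒜 S) (+-assoc s (suc t) (m′ * suc t))
      (eliminatePositive m′ ∣P-x∣≤m′
        (p⊆r∧q⊆r⇒p∪q⊆r N⊆S (p⊆q∪⁅x⁆∧x∉p⇒p⊆q (M⊆ ∘ p─q⊆p M ⁅ x ⁆) (x∉p-x M x)))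
        (resolve≤ x∈P x∈M d e)
        (branch ∘ p─q⊆p P ⁅ x ⁆))

-- One leaf for the falsified clause, and for each of three positive literals a subtree with its
-- resolution node.
treeSize : ℕ → ℕ
treeSize zero    = 1
treeSize (suc d) = 1 + 3 * suc (treeSize d)

-- The recurrence `t ↦ 3t + 4` has fixed point -2, so shifting by 2 turns it into tripling.
treeSize+2≡3*3^ : ∀ d → treeSize d + 2 ≡ 3 * 3 ^ d
treeSize+2≡3*3^ zero    = refl
treeSize+2≡3*3^ (suc d) = trans
  (solve 1 (λ t → con 1 :+ con 3 :* (con 1 :+ t) :+ con 2 := con 3 :* (t :+ con 2)) refl (treeSize d))
  (cong (3 *_) (treeSize+2≡3*3^ d))
  where open +-*-Solver

treeSize≡ : ∀ d → treeSize d ≡ 3 * 3 ^ d ∸ 2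
treeSize≡ d = trans (sym (m+n∸n≡m (treeSize d) 2)) (cong (_∸ 2) (treeSize+2≡3*3^ d))

module _ (Φ : CNF n) (k : ℕ) (Φ-3CNF : Is3CNF Φ) (Φ-unsat : Unsatisfiable Φ) where

  -- `d` counts the variables still to be added before an `atMost` clause applies. For `k ≥ n` that
  -- never happens: once `S` holds all variables, the falsified clause has no positive literal and
  -- there is no branching.
  negativeWithin : ∀ d S → d + ∣ S ∣ ≡ k + 1 → NegativeWithin (W1Clause Φ k) S (treeSize d)
  negativeWithin zero    S ∣S∣≡k+1 = S , ⊆-refl , initial (atMost S ∣S∣≡k+1) , ≤-refl
  negativeWithin (suc d) S d+∣S∣≡k
    -- A `Subset` is a boolean vector, so `lookupᵛ S` is its characteristic function.
    with C , C∈Φ , S⊭C ← find (¬All⇒Any¬ (lookupᵛ S ⊨?_) Φ (Φ-unsat (lookupᵛ S)))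
    = eliminatePositive 3 (≤-trans (m≤m+n _ _) (lookup Φ-3CNF C∈Φ))
        (falsified⇒negative⊆ S S⊭C) (initial (original C∈Φ) , ≤-refl)
        λ {x} x∈P → negativeWithin d (S ∪ ⁅ x ⁆)
          (trans (cong (d +_) (x∉p⇒∣p∪⁅x⁆∣≡1+∣p∣ (falsified⇒positive∉ S S⊭C x∈P)))
            (trans (+-suc d ∣ S ∣) d+∣S∣≡k))

  refutation : Σ (W1TreeRefutation Φ k) λ π → size π ≤ 3 * 3 ^ (k + 1) ∸ 2
  refutation
    with N , N⊆∅ , d ← negativeWithin (k + 1) ∅ (trans (cong (k + 1 +_) (∣⊥∣≡0 n)) (+-identityʳ _))
    = subst₂ (λ N s → Derivation≤ (W1Clause Φ k) (clause ∅ N) s)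
        (⊆-antisym N⊆∅ (⊆-min N)) (treeSize≡ (k + 1)) d

constᶜ : ℕ → Recursive n
constᶜ zero    = compᶜ zeroᶜ []
constᶜ (suc m) = compᶜ sucᶜ (constᶜ m ∷ [])

⇓const : ∀ m {as : Vec ℕ n} → constᶜ m · as ⇓ m
⇓const zero    = ⇓comp {bs = []} (λ ()) ⇓zero
⇓const (suc m) = ⇓comp {bs = m ∷ []} (λ { 0F → ⇓const m }) ⇓suc

addᶜ : Recursive 2
addᶜ = precᶜ (projᶜ 0F) (compᶜ sucᶜ (projᶜ 1F ∷ []))

⇓add : ∀ a b → addᶜ · a ∷ b ∷ [] ⇓ a + b
⇓add zero    b = ⇓prec₀ ⇓proj
⇓add (suc a) b = ⇓precₛ (⇓add a b) (⇓comp {bs = a + b ∷ []} (λ { 0F → ⇓proj }) ⇓suc)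

plusᶜ : Recursive n → Recursive n → Recursive n
plusᶜ g h = compᶜ addᶜ (g ∷ h ∷ [])

⇓plus : ∀ {g h : Recursive n} {as a b} → g · as ⇓ a → h · as ⇓ b → plusᶜ g h · as ⇓ a + b
⇓plus {a = a} {b} g⇓ h⇓ = ⇓comp {bs = a ∷ b ∷ []} (λ { 0F → g⇓ ; 1F → h⇓ }) (⇓add a b)

computable-3*3^ : Computable (λ k → 3 * 3 ^ (k + 1))
computable-3*3^ = precᶜ (constᶜ 9) (plusᶜ r (plusᶜ r (plusᶜ r (constᶜ 0)))) , ⇓3*3^
  where
  r : Recursive 2
  r = projᶜ 1F

  ⇓3*3^ : ∀ k → precᶜ (constᶜ 9) (plusᶜ r (plusᶜ r (plusᶜ r (constᶜ 0)))) · k ∷ [] ⇓ 3 * 3 ^ (k + 1)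
  ⇓3*3^ zero    = ⇓prec₀ (⇓const 9)
  -- `3 * r` unfolds to `r + (r + (r + 0))`, the very shape of the code.
  ⇓3*3^ (suc k) = ⇓precₛ (⇓3*3^ k) (⇓plus ⇓proj (⇓plus ⇓proj (⇓plus ⇓proj (⇓const 0))))

lemma4 : FptBounded (λ Φ k → Is3CNF Φ × Unsatisfiable Φ) ×
    (∀ {n} (Φ : CNF n) (k : ℕ) → Is3CNF Φ → Unsatisfiable Φ →
    Σ (W1TreeRefutation Φ k) λ π → size π ≤ 3 * 3 ^ (k + 1) ∸ 2)
-- Exponent 0: the bound depends on `k` alone.
lemma4 = ((λ k → 3 * 3 ^ (k + 1)) , computable-3*3^ , 0 , fpt) , refutation
  where
  fpt : ∀ {n} (Φ : CNF n) k → Is3CNF Φ × Unsatisfiable Φ →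
        Σ (W1TreeRefutation Φ k) λ π → size π ≤ 3 * 3 ^ (k + 1) * ‖ Φ ‖ ^ 0
  fpt Φ k (Φ-3CNF , Φ-unsat) with π , ∣π∣≤ ← refutation Φ k Φ-3CNF Φ-unsat =
    π , subst (size π ≤_) (sym (*-identityʳ (3 * 3 ^ (k + 1)))) (≤-trans ∣π∣≤ (m∸n≤m (3 * 3 ^ (k + 1)) 2))
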